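{- Let $k\ge 1$ and $n\geq 2$ be integers, let $r\in\mathbb{C}$, and let $\mathbf{P}_n=\mathrm{Circ}_r(P_{k,0},P_{k,1},\ldots,P_{k,n-1})$. Then $$\|\mathbf{P}_n\|_F=\sqrt{n\,\mathcal{S}^{(2)}_{n-1}+(|r|^2-1)\,\mathcal{W}^{(2)}_{n-1}}$$ and $$\|\mathbf{P}_n\|_1=n\,\mathcal{S}^{(1)}_{n-1}+(|r|-1)\,\mathcal{W}^{(1)}_{n-1}.$$
   Context: For an integer $k\geq 1$, the generalized $k$-Pell-Tribonacci sequence $(P_{k,n})_{n\ge 0}$ is defined by $P_{k,0}=0$, $P_{k,1}=1$, $P_{k,2}=2k$ and $P_{k,n}=2kP_{k,n-1}+kP_{k,n-2}+P_{k,n-3}$ for $n\geq 3$. Set $\mathcal{S}^{(1)}_n=\sum_{i=0}^n P_{k,i}$, $\mathcal{W}^{(1)}_n=\sum_{i=0}^n iP_{k,i}$, $\mathcal{S}^{(2)}_n=\sum_{i=0}^n P_{k,i}^2$, $\mathcal{W}^{(2)}_n=\sum_{i=0}^n iP_{k,i}^2$. For $n\ge 2$, $r\in\mathbb{C}$ and $a_0,\dots,a_{n-1}\in\mathbb{C}$, the $r$-circulant matrix $\mathrm{Circ}_r(a_0,\dots,a_{n-1})$ is the $n\times n$ matrix whose $(i,j)$ entry ($1\le i,j\le n$) is $a_{j-i}$ if $j\ge i$ and $r\,a_{n+j-i}$ if $j<i$. For $A=[a_{i,j}]\in\mathbb{C}^{n\times n}$: $\|A\|_F=\big(\sum_{i,j}|a_{i,j}|^2\big)^{1/2}$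 is the Frobenius norm and $\|A\|_1=\sum_{i,j}|a_{i,j}|$ is the entrywise $\ell_1$-norm. -}

module Defs where

open import Algebra.Bundles using (RawMonoid)
import Algebra.Definitions.RawMonoid as Sum
open import Data.Bool.Base using (T; true; false; if_then_else_)
open import Data.Empty using (⊥-elim)
open import Data.Fin.Base using (Fin; toℕ; fromℕ<)
import Data.Fin.Properties as Fin
open import Data.Integer.Base as ℤ using (ℤ; +_)
import Data.Integer.Properties as ℤ
open import Data.Nat.Base as ℕ using (ℕ; zero; suc; z≤n; s≤s; _∸_)
import Data.Nat.Properties as ℕ
import Data.Nat.Tactic.RingSolver as ℕ-Ring
open import Data.Product.Base using (∃-syntax; _×_; _,_)
open import Data.Rational.Base as ℚ using (ℚ; 0ℚ; 1ℚ; ½; ↥_; ↧ₙ_)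
import Data.Rational.Properties as ℚ
open import Data.Rational.Solver using (module +-*-Solver)
open import Data.Rational.Unnormalised.Base as ℚᵘ using (mkℚᵘ; *≡*; *≤*; *<*)
import Data.Rational.Unnormalised.Properties as ℚᵘ
open import Data.Sum.Base using (inj₁; inj₂)
open import Data.Vec.Functional using (Vector)
open import Level using (0ℓ)
open import Relation.Binary.PropositionalEquality
  using (_≡_; refl; sym; trans; cong; cong₂; subst; subst₂)
open import Relation.Nullary.Decidable.Core using (yes; no)
open import Relation.Nullary.Negation.Core using (¬_)

private
  module S = +-*-Solver

module ℚ-Lemmas where
  ½-pos : ∀ {ε} → 0ℚ ℚ.< ε → 0ℚ ℚ.< ½ ℚ.* ε
  ½-pos {ε} 0<ε =
    subst (ℚ._< ½ ℚ.* ε) (ℚ.*-zeroʳ ½) (ℚ.*-monoʳ-<-pos ½ 0<ε)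

  ½+½ : ∀ ε → ½ ℚ.* ε ℚ.+ ½ ℚ.* ε ≡ ε
  ½+½ ε = trans (sym (ℚ.*-distribʳ-+ ε ½ ½)) (ℚ.*-identityˡ ε)

  *-pos : ∀ {p q} → 0ℚ ℚ.< p → 0ℚ ℚ.< q → 0ℚ ℚ.< p ℚ.* q
  *-pos {p} {q} 0<p 0<q =
    ℚ.positive⁻¹ (p ℚ.* q)
      {{ℚ.pos*pos⇒pos p {{ℚ.positive 0<p}} q {{ℚ.positive 0<q}}}}

  *-mono-≤ : ∀ {p q r s} → 0ℚ ℚ.≤ p → p ℚ.≤ q → 0ℚ ℚ.≤ r → r ℚ.≤ s →
             p ℚ.* r ℚ.≤ q ℚ.* s
  *-mono-≤ {p} {q} {r} {s} 0≤p p≤q 0≤r r≤s = ℚ.≤-trans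
    (ℚ.*-monoʳ-≤-nonNeg r {{ℚ.nonNegative 0≤r}} p≤q)
    (ℚ.*-monoˡ-≤-nonNeg q {{ℚ.nonNegative (ℚ.≤-trans 0≤p p≤q)}} r≤s)

  p≤∣p∣ : ∀ p → p ℚ.≤ ℚ.∣ p ∣
  p≤∣p∣ p with ℚ.≤-total 0ℚ p
  ... | inj₁ 0≤p = ℚ.≤-reflexive (sym (ℚ.0≤p⇒∣p∣≡p 0≤p))
  ... | inj₂ p≤0 = ℚ.≤-trans p≤0 (ℚ.0≤∣p∣ p)

  sum-difference : ∀ a b c d →
    (a ℚ.- b) ℚ.+ (c ℚ.- d) ≡ (a ℚ.+ c) ℚ.- (b ℚ.+ d)
  sum-difference = S.solve 4 (λ a b c d →
    (a S.:- b) S.:+ (c S.:- d) S.:= (a S.:+ c) S.:- (b S.:+ d)) refl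

  product-difference : ∀ a b c d →
    a ℚ.* (c ℚ.- d) ℚ.+ d ℚ.* (a ℚ.- b) ≡ a ℚ.* c ℚ.- b ℚ.* d
  product-difference = S.solve 4 (λ a b c d →
    a S.:* (c S.:- d) S.:+ d S.:* (a S.:- b) S.:= a S.:* c S.:- b S.:* d) refl

  p-q+q≡p : ∀ p q → (p ℚ.- q) ℚ.+ q ≡ p
  p-q+q≡p = S.solve 2 (λ p q → (p S.:- q) S.:+ q S.:= p) refl

  p-q≡-[q-p] : ∀ p q → p ℚ.- q ≡ ℚ.- (q ℚ.- p)
  p-q≡-[q-p] = S.solve 2 (λ p q → p S.:- q S.:= S.:- (q S.:- p)) refl

  ∣-∣<⇒ : ∀ {p q δ} → ℚ.∣ p ℚ.- q ∣ ℚ.< δ → p ℚ.< q ℚ.+ δ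
  ∣-∣<⇒ {p} {q} {δ} h =
    subst (ℚ._< q ℚ.+ δ)
      (trans (ℚ.+-comm q (p ℚ.- q)) (p-q+q≡p p q))
      (ℚ.+-monoʳ-< q (ℚ.≤-<-trans (p≤∣p∣ (p ℚ.- q)) h))

  ∣-∣<⇐ : ∀ {p q δ} → p ℚ.< q ℚ.+ δ → q ℚ.< p ℚ.+ δ → ℚ.∣ p ℚ.- q ∣ ℚ.< δ
  ∣-∣<⇐ {p} {q} {δ} h₁ h₂ with ℚ.∣p∣≡p∨∣p∣≡-p (p ℚ.- q)
  ... | inj₁ e = subst₂ ℚ._<_ (sym e)
          (S.solve 2 (λ q δ → (q S.:+ δ) S.:- q S.:= δ) refl q δ)
          (ℚ.+-monoˡ-< (ℚ.- q) h₁)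
  ... | inj₂ e = subst₂ ℚ._<_ (trans (p-q≡-[q-p] q p) (sym e))
          (S.solve 2 (λ p δ → (p S.:+ δ) S.:- p S.:= δ) refl p δ)
          (ℚ.+-monoˡ-< (ℚ.- p) h₂)

open ℚ-Lemmas

-- Reals are Cauchy sequences of rationals, identified up to null sequences
-- by the setoid equality _≃_.

IsCauchy : (ℕ → ℚ) → Set
IsCauchy f = ∀ ε → 0ℚ ℚ.< ε →
  ∃[ N ] (∀ m n → N ℕ.≤ m → N ℕ.≤ n → ℚ.∣ f m ℚ.- f n ∣ ℚ.< ε)

record ℝ : Set where
  constructor mkℝ
  field
    seq    : ℕ → ℚ
    cauchy : IsCauchy seq

open ℝ public

infix 4 _≃_

_≃_ : ℝ → ℝ → Set
x ≃ y = ∀ ε → 0ℚ ℚ.< ε →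
        ∃[ N ] (∀ n → N ℕ.≤ n → ℚ.∣ seq x n ℚ.- seq y n ∣ ℚ.< ε)

fromℚ : ℚ → ℝ
fromℚ q = mkℝ (λ _ → q) λ ε 0<ε →
  0 , λ _ _ _ _ → subst (ℚ._< ε) (sym (cong ℚ.∣_∣ (ℚ.+-inverseʳ q))) 0<ε

fromℕ : ℕ → ℝ
fromℕ n = fromℚ (+ n ℚ./ 1)

0ℝ 1ℝ : ℝ
0ℝ = fromℕ 0
1ℝ = fromℕ 1

private
  ⊔ˡ : ∀ {a b c} → a ℕ.⊔ b ℕ.≤ c → a ℕ.≤ c
  ⊔ˡ {a} {b} = ℕ.m⊔n≤o⇒m≤o a b

  ⊔ʳ : ∀ {a b c} → a ℕ.⊔ b ℕ.≤ c → b ℕ.≤ c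
  ⊔ʳ {a} {b} = ℕ.m⊔n≤o⇒n≤o a b

infixl 6 _+_ _-_
infixl 7 _*_
infix  8 -_ _²

_+_ : ℝ → ℝ → ℝ
seq    (x + y) n = seq x n ℚ.+ seq y n
cauchy (x + y) ε 0<ε
  with cauchy x (½ ℚ.* ε) (½-pos 0<ε) | cauchy y (½ ℚ.* ε) (½-pos 0<ε)
... | N₁ , h₁ | N₂ , h₂ = N₁ ℕ.⊔ N₂ , λ m n p q →
  let a = seq x m; b = seq x n; c = seq y m; d = seq y n in
  ℚ.≤-<-trans
    (subst (λ t → ℚ.∣ t ∣ ℚ.≤ ℚ.∣ a ℚ.- b ∣ ℚ.+ ℚ.∣ c ℚ.- d ∣)
      (sum-difference a b c d)
      (ℚ.∣p+q∣≤∣p∣+∣q∣ (a ℚ.- b) (c ℚ.- d)))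
    (subst (ℚ.∣ a ℚ.- b ∣ ℚ.+ ℚ.∣ c ℚ.- d ∣ ℚ.<_) (½+½ ε)
      (ℚ.+-mono-< (h₁ m n (⊔ˡ p) (⊔ˡ q)) (h₂ m n (⊔ʳ p) (⊔ʳ q))))

-_ : ℝ → ℝ
seq    (- x) n = ℚ.- seq x n
cauchy (- x) ε 0<ε with cauchy x ε 0<ε
... | N , h = N , λ m n p q →
  subst (ℚ._< ε)
    (cong ℚ.∣_∣ (S.solve 2 (λ a b → a S.:- b S.:= (S.:- b) S.:- (S.:- a)) refl
      (seq x n) (seq x m)))
    (h n m q p)

_-_ : ℝ → ℝ → ℝ
x - y = x + (- y)

module Cauchy-Lemmas where
  eventually-bounded : ∀ f → IsCauchy f → ∃[ B ] ∃[ N ]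
    (0ℚ ℚ.< B × (∀ n → N ℕ.≤ n → ℚ.∣ f n ∣ ℚ.≤ B))
  eventually-bounded f f-cauchy with f-cauchy 1ℚ (ℚ.positive⁻¹ 1ℚ)
  ... | N , h = 1ℚ ℚ.+ ℚ.∣ f N ∣ , N
      , ℚ.<-≤-trans (ℚ.positive⁻¹ 1ℚ)
          (subst (ℚ._≤ 1ℚ ℚ.+ ℚ.∣ f N ∣) (ℚ.+-identityʳ 1ℚ)
            (ℚ.+-monoʳ-≤ 1ℚ (ℚ.0≤∣p∣ (f N))))
      , λ n p → ℚ.≤-trans
          (subst (λ t → ℚ.∣ t ∣ ℚ.≤ ℚ.∣ f n ℚ.- f N ∣ ℚ.+ ℚ.∣ f N ∣)
            (p-q+q≡p (f n) (f N))
            (ℚ.∣p+q∣≤∣p∣+∣q∣ (f n ℚ.- f N) (f N)))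
          (ℚ.+-monoˡ-≤ ℚ.∣ f N ∣ (ℚ.<⇒≤ (h n N p ℕ.≤-refl)))

  divide : ∀ B δ → 0ℚ ℚ.< B → 0ℚ ℚ.< δ → ∃[ η ] (0ℚ ℚ.< η × B ℚ.* η ≡ δ)
  divide B δ 0<B 0<δ = 1/B ℚ.* δ , *-pos 0<1/B 0<δ
    , trans (sym (ℚ.*-assoc B 1/B δ))
        (trans (cong (ℚ._* δ) (ℚ.*-inverseʳ B)) (ℚ.*-identityˡ δ))
    where
    instance
      B-pos : ℚ.Positive B
      B-pos = ℚ.positive 0<B
      B-nonZero : ℚ.NonZero B
      B-nonZero = ℚ.pos⇒nonZero B
    1/B = ℚ.1/ B
    0<1/B : 0ℚ ℚ.< 1/B
    0<1/B = ℚ.positive⁻¹ 1/B {{ℚ.1/pos⇒pos B}}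

  *-small : ∀ {B η δ p q} → B ℚ.* η ≡ δ → 0ℚ ℚ.< B →
            ℚ.∣ p ∣ ℚ.≤ B → ℚ.∣ q ∣ ℚ.< η → ℚ.∣ p ℚ.* q ∣ ℚ.< δ
  *-small {B} {η} {δ} {p} {q} Bη≡δ 0<B p≤B q<η =
    subst₂ ℚ._<_ (sym (ℚ.∣p*q∣≡∣p∣*∣q∣ p q)) Bη≡δ
      (ℚ.≤-<-trans
        (ℚ.*-monoʳ-≤-nonNeg ℚ.∣ q ∣ {{ℚ.nonNegative (ℚ.0≤∣p∣ q)}} p≤B)
        (ℚ.*-monoʳ-<-pos B {{ℚ.positive 0<B}} q<η))

  *-close : ∀ {B C η θ ε} a b c d → 0ℚ ℚ.< B → 0ℚ ℚ.< C →
            B ℚ.* η ≡ ½ ℚ.* ε → C ℚ.* θ ≡ ½ ℚ.* ε →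
            ℚ.∣ a ∣ ℚ.≤ B → ℚ.∣ d ∣ ℚ.≤ C →
            ℚ.∣ c ℚ.- d ∣ ℚ.< η → ℚ.∣ a ℚ.- b ∣ ℚ.< θ →
            ℚ.∣ a ℚ.* c ℚ.- b ℚ.* d ∣ ℚ.< ε
  *-close {ε = ε} a b c d 0<B 0<C Bη Cθ a≤B d≤C c-d<η a-b<θ = ℚ.≤-<-trans
    (subst (λ t → ℚ.∣ t ∣ ℚ.≤ ℚ.∣ a ℚ.* (c ℚ.- d) ∣ ℚ.+ ℚ.∣ d ℚ.* (a ℚ.- b) ∣)
      (product-difference a b c d)
      (ℚ.∣p+q∣≤∣p∣+∣q∣ (a ℚ.* (c ℚ.- d)) (d ℚ.* (a ℚ.- b))))
    (subst (ℚ.∣ a ℚ.* (c ℚ.- d) ∣ ℚ.+ ℚ.∣ d ℚ.* (a ℚ.- b) ∣ ℚ.<_) (½+½ ε)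
      (ℚ.+-mono-< (*-small {p = a} {q = c ℚ.- d} Bη 0<B a≤B c-d<η)
                  (*-small {p = d} {q = a ℚ.- b} Cθ 0<C d≤C a-b<θ)))

  -- Unfolding this during type checking is prohibitively slow.
  abstract
    *-cauchy : ∀ f g → IsCauchy f → IsCauchy g → IsCauchy (λ n → f n ℚ.* g n)
    *-cauchy f g f-cauchy g-cauchy ε 0<ε =
      let B , M  , 0<B , hB = eventually-bounded f f-cauchy
          C , M′ , 0<C , hC = eventually-bounded g g-cauchy
          η , 0<η , Bη = divide B (½ ℚ.* ε) 0<B (½-pos 0<ε)
          θ , 0<θ , Cθ = divide C (½ ℚ.* ε) 0<C (½-pos 0<ε)
          N  , hN  = g-cauchy η 0<η
          N′ , hN′ = f-cauchy θ 0<θ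
      in close 0<B 0<C Bη Cθ hB hC hN hN′
      where
      close : ∀ {B C η θ M M′ N N′} → 0ℚ ℚ.< B → 0ℚ ℚ.< C →
              B ℚ.* η ≡ ½ ℚ.* ε → C ℚ.* θ ≡ ½ ℚ.* ε →
              (∀ n → M  ℕ.≤ n → ℚ.∣ f n ∣ ℚ.≤ B) →
              (∀ n → M′ ℕ.≤ n → ℚ.∣ g n ∣ ℚ.≤ C) →
              (∀ m n → N  ℕ.≤ m → N  ℕ.≤ n → ℚ.∣ g m ℚ.- g n ∣ ℚ.< η) →
              (∀ m n → N′ ℕ.≤ m → N′ ℕ.≤ n → ℚ.∣ f m ℚ.- f n ∣ ℚ.< θ) →
              ∃[ K ] (∀ m n → K ℕ.≤ m → K ℕ.≤ n →
                ℚ.∣ f m ℚ.* g m ℚ.- f n ℚ.* g n ∣ ℚ.< ε)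
      close {M = M} {M′} {N} {N′} 0<B 0<C Bη Cθ hB hC hN hN′ =
        (M ℕ.⊔ M′) ℕ.⊔ (N ℕ.⊔ N′) , λ m n p q →
          let pM = ⊔ˡ {M ℕ.⊔ M′} p; pN = ⊔ʳ {M ℕ.⊔ M′} p
              qM = ⊔ˡ {M ℕ.⊔ M′} q; qN = ⊔ʳ {M ℕ.⊔ M′} q
          in *-close (f m) (f n) (g m) (g n) 0<B 0<C Bη Cθ
               (hB m (⊔ˡ {M} pM)) (hC n (⊔ʳ {M} qM))
               (hN m n (⊔ˡ {N} pN) (⊔ˡ {N} qN))
               (hN′ m n (⊔ʳ {N} pN) (⊔ʳ {N} qN))

open Cauchy-Lemmas

_*_ : ℝ → ℝ → ℝ
seq    (x * y) n = seq x n ℚ.* seq y n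
cauchy (x * y)   = *-cauchy (seq x) (seq y) (cauchy x) (cauchy y)

_² : ℝ → ℝ
x ² = x * x

-- ⌊√ m ⌋
isqrt : ℕ → ℕ
isqrt zero    = 0
isqrt (suc m) = next (isqrt m)
  where
  next : ℕ → ℕ
  next s = if suc s ℕ.* suc s ℕ.≤ᵇ suc m then suc s else s

isqrt-lower : ∀ m → isqrt m ℕ.* isqrt m ℕ.≤ m
isqrt-lower zero = z≤n
isqrt-lower (suc m) with suc (isqrt m) ℕ.* suc (isqrt m) ℕ.≤ᵇ suc m in eq
... | true  = ℕ.≤ᵇ⇒≤ _ _ (subst T (sym eq) _)
... | false = ℕ.m≤n⇒m≤1+n (isqrt-lower m)

isqrt-upper : ∀ m → m ℕ.< suc (isqrt m) ℕ.* suc (isqrt m)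
isqrt-upper zero = s≤s z≤n
isqrt-upper (suc m) with suc (isqrt m) ℕ.* suc (isqrt m) ℕ.≤ᵇ suc m in eq
... | true  = ℕ.≤-<-trans (isqrt-upper m)
                (ℕ.*-mono-< (ℕ.n<1+n (suc (isqrt m))) (ℕ.n<1+n (suc (isqrt m))))
... | false = ℕ.≰⇒> λ p → subst T eq (ℕ.≤⇒≤ᵇ p)

-- For q = a/b ≥ 0 and t = n + 1, this is √(abt²)/(bt) with the numerator
-- rounded down, so the error is less than 1/t (√ℚ-lower and √ℚ-upper below).
√ℚ : ℕ → ℚ → ℚ
√ℚ n q = + isqrt (ℤ.∣ ↥ q ∣ ℕ.* ↧ₙ q ℕ.* (suc n ℕ.* suc n)) ℚ./ (↧ₙ q ℕ.* suc n)

module ι-Lemmas where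
  ι : ℕ → ℚ
  ι n = + n ℚ./ 1

  ι-ᵘ : ∀ n → ℚ.toℚᵘ (ι n) ℚᵘ.≃ mkℚᵘ (+ n) 0
  ι-ᵘ n = ℚ.toℚᵘ-fromℚᵘ (mkℚᵘ (+ n) 0)

  ι-+ : ∀ m n → ι m ℚ.+ ι n ≡ ι (m ℕ.+ n)
  ι-+ m n = ℚ.toℚᵘ-injective (ℚᵘ.≃-trans (ℚ.toℚᵘ-homo-+ (ι m) (ι n))
    (ℚᵘ.≃-trans (ℚᵘ.+-cong (ι-ᵘ m) (ι-ᵘ n))
      (ℚᵘ.≃-trans (*≡* (cong (ℤ._* + 1)
        (cong₂ ℤ._+_ (ℤ.*-identityʳ (+ m)) (ℤ.*-identityʳ (+ n)))))
        (ℚᵘ.≃-sym (ι-ᵘ (m ℕ.+ n))))))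

  ι-* : ∀ m n → ι m ℚ.* ι n ≡ ι (m ℕ.* n)
  ι-* m n = ℚ.toℚᵘ-injective (ℚᵘ.≃-trans (ℚ.toℚᵘ-homo-* (ι m) (ι n))
    (ℚᵘ.≃-trans (ℚᵘ.*-cong (ι-ᵘ m) (ι-ᵘ n))
      (ℚᵘ.≃-trans (*≡* (cong (ℤ._* + 1) (sym (ℤ.pos-* m n))))
        (ℚᵘ.≃-sym (ι-ᵘ (m ℕ.* n))))))

  /-ι : ∀ m d → (+ m ℚ./ suc d) ℚ.* ι (suc d) ≡ ι m
  /-ι m d = ℚ.toℚᵘ-injective (ℚᵘ.≃-trans (ℚ.toℚᵘ-homo-* (+ m ℚ./ suc d) (ι (suc d)))
    (ℚᵘ.≃-trans (ℚᵘ.*-cong (ℚ.toℚᵘ-fromℚᵘ (mkℚᵘ (+ m) d)) (ι-ᵘ (suc d)))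
      (ℚᵘ.≃-trans (*≡* (trans (ℤ.*-identityʳ _)
        (cong (λ t → + m ℤ.* + t) (sym (ℕ.*-identityʳ (suc d))))))
        (ℚᵘ.≃-sym (ι-ᵘ m)))))

  ι-mono-≤ : ∀ {m n} → m ℕ.≤ n → ι m ℚ.≤ ι n
  ι-mono-≤ {m} {n} m≤n = ℚ.toℚᵘ-cancel-≤
    (ℚᵘ.≤-respˡ-≃ (ℚᵘ.≃-sym (ι-ᵘ m)) (ℚᵘ.≤-respʳ-≃ (ℚᵘ.≃-sym (ι-ᵘ n))
      (*≤* (ℤ.*-monoʳ-≤-nonNeg (+ 1) (ℤ.+≤+ m≤n)))))

  ι-mono-< : ∀ {m n} → m ℕ.< n → ι m ℚ.< ι n
  ι-mono-< {m} {n} m<n = ℚ.toℚᵘ-cancel-<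
    (ℚᵘ.<-respˡ-≃ (ℚᵘ.≃-sym (ι-ᵘ m)) (ℚᵘ.<-respʳ-≃ (ℚᵘ.≃-sym (ι-ᵘ n))
      (*<* (ℤ.*-monoʳ-<-pos (+ 1) (ℤ.+<+ m<n)))))

  [bt]²≡b[bt²] : ∀ b t → b ℕ.* t ℕ.* (b ℕ.* t) ≡ b ℕ.* (b ℕ.* (t ℕ.* t))
  [bt]²≡b[bt²] = ℕ-Ring.solve-∀

  ∣↥∣/↧ : ∀ {q} → 0ℚ ℚ.≤ q → + ℤ.∣ ↥ q ∣ ℚ./ ↧ₙ q ≡ q
  ∣↥∣/↧ {q@(ℚ.mkℚ _ _ _)} 0≤q = trans
    (cong (ℚ._/ ↧ₙ q) (ℤ.0≤i⇒+∣i∣≡i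
      (ℤ.nonNegative⁻¹ (↥ q) {{ℚ.nonNegative 0≤q}})))
    (ℚ.↥p/↧p≡p q)

open ι-Lemmas

step : ℕ → ℚ
step n = + 1 ℚ./ suc n

√ℚ-nonNeg : ∀ n q → 0ℚ ℚ.≤ √ℚ n q
√ℚ-nonNeg n q = ℚ.nonNegative⁻¹ (√ℚ n q)
  {{ℚ.normalize-nonNeg (isqrt (ℤ.∣ ↥ q ∣ ℕ.* ↧ₙ q ℕ.* (suc n ℕ.* suc n))) (↧ₙ q ℕ.* suc n)}}

module _ (n : ℕ) {q : ℚ} (0≤q : 0ℚ ℚ.≤ q) where
  private
    a b t s d : ℕ
    a = ℤ.∣ ↥ q ∣
    b = ↧ₙ q
    t = suc n
    s = isqrt (a ℕ.* b ℕ.* (t ℕ.* t))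
    d = ℚ.denominator-1 q

    D : ℚ
    D = ι (b ℕ.* t)

    instance
      D-pos : ℚ.Positive D
      D-pos = ℚ.normalize-pos (b ℕ.* t) 1
      D²-pos : ℚ.Positive (D ℚ.* D)
      D²-pos = ℚ.pos*pos⇒pos D D
      D²-nonNeg : ℚ.NonNegative (D ℚ.* D)
      D²-nonNeg = ℚ.pos⇒nonNeg (D ℚ.* D)

    yD : √ℚ n q ℚ.* D ≡ ι s
    yD = /-ι s _

    qD² : q ℚ.* (D ℚ.* D) ≡ ι (a ℕ.* b ℕ.* (t ℕ.* t))
    qD² = trans (cong (q ℚ.*_) (trans (ι-* (b ℕ.* t) (b ℕ.* t))
            (trans (cong ι ([bt]²≡b[bt²] b t)) (sym (ι-* b (b ℕ.* (t ℕ.* t)))))))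
          (trans (sym (ℚ.*-assoc q (ι b) (ι (b ℕ.* (t ℕ.* t)))))
            (trans (cong (ℚ._* ι (b ℕ.* (t ℕ.* t)))
                (trans (cong (ℚ._* ι b) (sym (∣↥∣/↧ 0≤q))) (/-ι a d)))
              (trans (ι-* a (b ℕ.* (t ℕ.* t)))
                (cong ι (sym (ℕ.*-assoc a b (t ℕ.* t)))))))

    δD : step n ℚ.* D ≡ ι b
    δD = trans (cong (step n ℚ.*_) (trans (cong ι (ℕ.*-comm b t)) (sym (ι-* t b))))
          (trans (sym (ℚ.*-assoc (step n) (ι t) (ι b)))
            (trans (cong (ℚ._* ι b) (/-ι 1 n)) (ℚ.*-identityˡ (ι b))))

    square : ∀ p → (p ℚ.* p) ℚ.* (D ℚ.* D) ≡ (p ℚ.* D) ℚ.* (p ℚ.* D)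
    square p = S.solve 2 (λ p D → (p S.:* p) S.:* (D S.:* D)
                             S.:= (p S.:* D) S.:* (p S.:* D)) refl p D

  √ℚ-lower : √ℚ n q ℚ.* √ℚ n q ℚ.≤ q
  √ℚ-lower = ℚ.*-cancelʳ-≤-pos (D ℚ.* D)
    (subst₂ ℚ._≤_
      (sym (trans (square (√ℚ n q)) (trans (cong₂ ℚ._*_ yD yD) (ι-* s s))))
      (sym qD²)
      (ι-mono-≤ (isqrt-lower (a ℕ.* b ℕ.* (t ℕ.* t)))))

  √ℚ-upper : q ℚ.< (√ℚ n q ℚ.+ step n) ℚ.* (√ℚ n q ℚ.+ step n)
  √ℚ-upper = ℚ.*-cancelʳ-<-nonNeg (D ℚ.* D)
    (subst₂ ℚ._<_ (sym qD²)
      (sym (trans (square (√ℚ n q ℚ.+ step n)) (trans (cong₂ ℚ._*_ zD zD)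
        (ι-* (s ℕ.+ b) (s ℕ.+ b)))))
      (ι-mono-< (ℕ.<-≤-trans (isqrt-upper (a ℕ.* b ℕ.* (t ℕ.* t)))
        (ℕ.*-mono-≤ s+1≤s+b s+1≤s+b))))
    where
    zD : (√ℚ n q ℚ.+ step n) ℚ.* D ≡ ι (s ℕ.+ b)
    zD = trans (ℚ.*-distribʳ-+ D (√ℚ n q) (step n))
          (trans (cong₂ ℚ._+_ yD δD) (ι-+ s b))
    s+1≤s+b : suc s ℕ.≤ s ℕ.+ b
    s+1≤s+b = subst (ℕ._≤ s ℕ.+ b) (ℕ.+-comm s 1) (ℕ.+-monoʳ-≤ s (s≤s z≤n))

module √-Lemmas where
  step-pos : ∀ n → 0ℚ ℚ.< step n
  step-pos n = ℚ.positive⁻¹ (step n) {{ℚ.normalize-pos 1 (suc n)}}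

  step-antitone : ∀ {m n} → m ℕ.≤ n → step n ℚ.≤ step m
  step-antitone {m} {n} m≤n = ℚ.toℚᵘ-cancel-≤
    (ℚᵘ.≤-respˡ-≃ (ℚᵘ.≃-sym (ℚ.toℚᵘ-fromℚᵘ (mkℚᵘ (+ 1) n)))
      (ℚᵘ.≤-respʳ-≃ (ℚᵘ.≃-sym (ℚ.toℚᵘ-fromℚᵘ (mkℚᵘ (+ 1) m)))
        (*≤* (ℤ.*-monoˡ-≤-nonNeg (+ 1) (ℤ.+≤+ (s≤s m≤n))))))

  -- ε = a/(d + 1) ≥ 1/(d + 1)
  archimedean : ∀ ε → 0ℚ ℚ.< ε → ∃[ N ] step N ℚ.≤ ε
  archimedean ε 0<ε = d , ℚ.*-cancelʳ-≤-pos (ι (suc d)) {{ℚ.normalize-pos (suc d) 1}}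
    (subst₂ ℚ._≤_ (sym (/-ι 1 d))
      (sym (trans (cong (ℚ._* ι (suc d)) (sym (∣↥∣/↧ (ℚ.<⇒≤ 0<ε)))) (/-ι ℤ.∣ ↥ ε ∣ d)))
      (ι-mono-≤ (numerator-pos ε (ℚ.positive 0<ε))))
    where
    d = ℚ.denominator-1 ε
    numerator-pos : ∀ p → ℚ.Positive p → 1 ℕ.≤ ℤ.∣ ↥ p ∣
    numerator-pos (ℚ.mkℚ (+ suc _) _ _) _ = s≤s z≤n

  √ℚ-continuous : ∀ {p q δ} m n → 0ℚ ℚ.≤ p → 0ℚ ℚ.≤ q → 0ℚ ℚ.< δ → step n ℚ.≤ δ →
                  p ℚ.< q ℚ.+ δ ℚ.* δ → √ℚ m p ℚ.< √ℚ n q ℚ.+ (δ ℚ.+ δ)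
  √ℚ-continuous {p} {q} {δ} m n 0≤p 0≤q 0<δ step≤δ p<q+δ²
    with √ℚ m p ℚ.<? √ℚ n q ℚ.+ (δ ℚ.+ δ)
  ... | yes lt = lt
  ... | no ¬lt = ⊥-elim (ℚ.<-irrefl refl (ℚ.<-trans p<q+δ² (ℚ.<-≤-trans
        (ℚ.+-monoˡ-< (δ ℚ.* δ) (√ℚ-upper n 0≤q))
        (ℚ.≤-trans (ℚ.≤-trans u²+δ²≤[u+δ]² (*-mono-≤ 0≤u+δ u+δ≤y 0≤u+δ u+δ≤y))
          (√ℚ-lower m 0≤p)))))
    where
    y = √ℚ n q
    u = y ℚ.+ step n
    0≤δ : 0ℚ ℚ.≤ δ
    0≤δ = ℚ.<⇒≤ 0<δ
    0≤u : 0ℚ ℚ.≤ u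
    0≤u = ℚ.+-mono-≤ (√ℚ-nonNeg n q) (ℚ.<⇒≤ (step-pos n))
    0≤u+δ : 0ℚ ℚ.≤ u ℚ.+ δ
    0≤u+δ = ℚ.+-mono-≤ 0≤u 0≤δ
    u+δ≤y : u ℚ.+ δ ℚ.≤ √ℚ m p
    u+δ≤y = ℚ.≤-trans
      (subst (u ℚ.+ δ ℚ.≤_) (ℚ.+-assoc y δ δ)
        (ℚ.+-monoˡ-≤ δ (ℚ.+-monoʳ-≤ y step≤δ)))
      (ℚ.≮⇒≥ ¬lt)
    0≤uδ : 0ℚ ℚ.≤ u ℚ.* δ
    0≤uδ = *-mono-≤ ℚ.≤-refl 0≤u ℚ.≤-refl 0≤δ
    u²+δ²≤[u+δ]² : u ℚ.* u ℚ.+ δ ℚ.* δ ℚ.≤ (u ℚ.+ δ) ℚ.* (u ℚ.+ δ)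
    u²+δ²≤[u+δ]² = subst₂ ℚ._≤_
      (ℚ.+-identityʳ (u ℚ.* u ℚ.+ δ ℚ.* δ))
      (S.solve 2 (λ u δ → (u S.:* u S.:+ δ S.:* δ) S.:+ (u S.:* δ S.:+ u S.:* δ)
                     S.:= (u S.:+ δ) S.:* (u S.:+ δ)) refl u δ)
      (ℚ.+-monoʳ-≤ (u ℚ.* u ℚ.+ δ ℚ.* δ) (ℚ.+-mono-≤ 0≤uδ 0≤uδ))

  ⊔0-lipschitz : ∀ {p q δ} → 0ℚ ℚ.< δ → p ℚ.< q ℚ.+ δ → p ℚ.⊔ 0ℚ ℚ.< (q ℚ.⊔ 0ℚ) ℚ.+ δ
  ⊔0-lipschitz {p} {q} {δ} 0<δ h with ℚ.≤-total 0ℚ p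
  ... | inj₁ 0≤p = subst (ℚ._< (q ℚ.⊔ 0ℚ) ℚ.+ δ) (sym (ℚ.p≥q⇒p⊔q≡p 0≤p))
          (ℚ.<-≤-trans h (ℚ.+-monoˡ-≤ δ (ℚ.p≤p⊔q q 0ℚ)))
  ... | inj₂ p≤0 = subst (ℚ._< (q ℚ.⊔ 0ℚ) ℚ.+ δ) (sym (ℚ.p≤q⇒p⊔q≡q p≤0))
          (ℚ.+-mono-≤-< (ℚ.p≤q⊔p q 0ℚ) 0<δ)

  abstract
    √-cauchy : ∀ f → IsCauchy f → IsCauchy (λ n → √ℚ n (f n ℚ.⊔ 0ℚ))
    √-cauchy f f-cauchy ε 0<ε =
      let 0<δ    = ½-pos 0<ε
          M , hM = archimedean (½ ℚ.* ε) 0<δ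
          N , hN = f-cauchy ((½ ℚ.* ε) ℚ.* (½ ℚ.* ε)) (*-pos 0<δ 0<δ)
      in close {½ ℚ.* ε} {M} {N} 0<δ (½+½ ε) hM hN
      where
      close : ∀ {δ M N} → 0ℚ ℚ.< δ → δ ℚ.+ δ ≡ ε → step M ℚ.≤ δ →
              (∀ m n → N ℕ.≤ m → N ℕ.≤ n → ℚ.∣ f m ℚ.- f n ∣ ℚ.< δ ℚ.* δ) →
              ∃[ K ] (∀ m n → K ℕ.≤ m → K ℕ.≤ n →
                ℚ.∣ √ℚ m (f m ℚ.⊔ 0ℚ) ℚ.- √ℚ n (f n ℚ.⊔ 0ℚ) ∣ ℚ.< ε)
      close {δ} {M} {N} 0<δ δ+δ≡ε hM hN = M ℕ.⊔ N , λ m n p q →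
        ∣-∣<⇐ {√ℚ m (f m ℚ.⊔ 0ℚ)} {√ℚ n (f n ℚ.⊔ 0ℚ)} (bound m n p q) (bound n m q p)
        where
        bound : ∀ m n → M ℕ.⊔ N ℕ.≤ m → M ℕ.⊔ N ℕ.≤ n →
                √ℚ m (f m ℚ.⊔ 0ℚ) ℚ.< √ℚ n (f n ℚ.⊔ 0ℚ) ℚ.+ ε
        bound m n p q =
          subst (λ t → √ℚ m (f m ℚ.⊔ 0ℚ) ℚ.< √ℚ n (f n ℚ.⊔ 0ℚ) ℚ.+ t) δ+δ≡ε
            (√ℚ-continuous m n (ℚ.p≤q⊔p (f m) 0ℚ) (ℚ.p≤q⊔p (f n) 0ℚ) 0<δ
              (ℚ.≤-trans (step-antitone (⊔ˡ {M} {N} q)) hM)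
              (⊔0-lipschitz {f m} {f n} (*-pos 0<δ 0<δ)
                (∣-∣<⇒ (hN m n (⊔ʳ {M} {N} p) (⊔ʳ {M} {N} q)))))

open √-Lemmas

-- Total: √ x ≃ 0 for negative x.
√ : ℝ → ℝ
seq    (√ x) n = √ℚ n (seq x n ℚ.⊔ 0ℚ)
cauchy (√ x)   = √-cauchy (seq x) (cauchy x)

infix 4 _+i_

record ℂ : Set where
  constructor _+i_
  field
    re im : ℝ

open ℂ public

infixl 7 _*ᶜ_

_*ᶜ_ : ℂ → ℂ → ℂ
z *ᶜ w = re z * re w - im z * im w +i re z * im w + im z * re w

∣_∣ : ℂ → ℝ
∣ z ∣ = √ (re z ² + im z ²)

fromℕᶜ : ℕ → ℂ
fromℕᶜ n = fromℕ n +i 0ℝ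

+-rawMonoid : RawMonoid 0ℓ 0ℓ
+-rawMonoid = record { Carrier = ℝ ; _≈_ = _≃_ ; _∙_ = _+_ ; ε = 0ℝ }

∑ : ∀ {n} → Vector ℝ n → ℝ
∑ = Sum.sum +-rawMonoid

Matrix : ℕ → Set
Matrix n = Fin n → Fin n → ℂ

‖_‖F : ∀ {n} → Matrix n → ℝ
‖ A ‖F = √ (∑ λ i → ∑ λ j → ∣ A i j ∣ ²)

‖_‖₁ : ∀ {n} → Matrix n → ℝ
‖ A ‖₁ = ∑ λ i → ∑ λ j → ∣ A i j ∣

private
  upper< : ∀ {n} (i j : Fin n) → toℕ j ∸ toℕ i ℕ.< n
  upper< i j = ℕ.≤-<-trans (ℕ.m∸n≤m (toℕ j) (toℕ i)) (Fin.toℕ<n j)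

  lower< : ∀ {n} (i j : Fin n) → ¬ (toℕ i ℕ.≤ toℕ j) → n ℕ.+ toℕ j ∸ toℕ i ℕ.< n
  lower< {n} i j i≰j = ℕ.m<n+o⇒m∸n<o (n ℕ.+ toℕ j) (toℕ i)
    {{Fin.nonZeroIndex i}}
    (subst (n ℕ.+ toℕ j ℕ.<_) (ℕ.+-comm n (toℕ i)) (ℕ.+-monoʳ-< n (ℕ.≰⇒> i≰j)))

-- Rows and columns are indexed from 0, which leaves j - i unchanged.
Circ : ∀ {n} → ℂ → Vector ℂ n → Matrix n
Circ r a i j with toℕ i ℕ.≤? toℕ j
... | yes _  = a (fromℕ< (upper< i j))
... | no i≰j = r *ᶜ a (fromℕ< (lower< i j i≰j))

-- P k n is the n-th term of the k-Pell-Tribonacci sequence.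
P : ℕ → ℕ → ℕ
P k 0 = 0
P k 1 = 1
P k 2 = 2 ℕ.* k
P k (suc (suc (suc n))) =
  2 ℕ.* k ℕ.* P k (suc (suc n)) ℕ.+ k ℕ.* P k (suc n) ℕ.+ P k n

-- f 0 + ⋯ + f n
sum-to : ℕ → (ℕ → ℕ) → ℕ
sum-to n f = Sum.sum ℕ.+-0-rawMonoid {suc n} λ i → f (toℕ i)

S⁽¹⁾ W⁽¹⁾ S⁽²⁾ W⁽²⁾ : ℕ → ℕ → ℕ
S⁽¹⁾ k n = sum-to n λ i → P k i
W⁽¹⁾ k n = sum-to n λ i → i ℕ.* P k i
S⁽²⁾ k n = sum-to n λ i → P k i ℕ.^ 2
W⁽²⁾ k n = sum-to n λ i → i ℕ.* P k i ℕ.^ 2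

{-# OPTIONS --safe #-}
-- Row i of the matrix holds f 0, …, f (n - i - 1) on and right of the diagonal
-- and x f (n - i), …, x f (n - 1) left of it, so it sums to
-- ∑ f + (x - 1) (f (n - i) + ⋯ + f (n - 1)); over all rows, f m occurs m times
-- in the second part. This is applied to f = P, x = |r| and to f = P², x = |r|².
module Submission where

open import Algebra.Bundles using (Semiring)
import Algebra.Definitions.RawMonoid as RawMonoidDefinitions
import Algebra.Properties.CommutativeSemigroup as CommutativeSemigroupProperties
import Algebra.Properties.Semiring.Mult as SemiringMult
import Algebra.Properties.Semiring.Sum as SemiringSum
open import Defs
open import Data.Empty using (⊥-elim)
open import Data.Fin.Base as Fin using (Fin; toℕ)
import Data.Fin.Properties as Fin
open import Data.Nat.Base as ℕ using (ℕ; zero; suc; _≤_; z≤n; s≤s; _∸_)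
import Data.Nat.Properties as ℕ
open import Data.Product.Base using (∃-syntax; _×_; _,_)
open import Data.Rational.Base as ℚ using (ℚ; 0ℚ; 1ℚ; ½)
import Data.Rational.Properties as ℚ
open import Data.Rational.Solver using (module +-*-Solver)
open import Data.Sum.Base using (inj₁; inj₂)
open import Function.Base using (_∘_)
open import Level using (0ℓ)
open import Relation.Binary.PropositionalEquality as ≡ using (_≡_; cong; subst)
open import Relation.Binary.Structures using (IsEquivalence)
import Relation.Binary.Reasoning.Setoid as SetoidReasoning
open import Relation.Nullary.Decidable.Core using (yes; no)

open ℚ-Lemmas
open Cauchy-Lemmas
open ι-Lemmas
open √-Lemmas

private
  module S = +-*-Solver

-- Double sums over circulant arrays in a semiring.

module CirculantSum {a ℓ} (R : Semiring a ℓ) where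
  open Semiring R renaming (_+_ to _⊕_; _*_ to _⊗_)
  open SemiringSum R using (sum; sum-cong-≋; sum-replicate; ∑-distrib-+; *-distribˡ-sum)
  open SemiringMult R using () renaming (_×_ to _·_)
  open CommutativeSemigroupProperties +-commutativeSemigroup using (x∙yz≈y∙xz)
  open SetoidReasoning setoid

  sum-below : ∀ n → (ℕ → Carrier) → Carrier
  sum-below n f = sum {n} (f ∘ toℕ)

  sum-below-suc : ∀ n f → sum-below (suc n) f ≈ sum-below n f ⊕ f n
  sum-below-suc zero    f = +-comm (f 0) 0#
  sum-below-suc (suc n) f = trans (+-congˡ (sum-below-suc n (f ∘ suc)))
    (sym (+-assoc (f 0) (sum-below n (f ∘ suc)) (f (suc n))))

  sum-below-+ : ∀ m n f →
    sum-below (m ℕ.+ n) f ≈ sum-below m f ⊕ sum-below n (f ∘ (m ℕ.+_))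
  sum-below-+ zero    n f = sym (+-identityˡ _)
  sum-below-+ (suc m) n f = trans (+-congˡ (sum-below-+ m n (f ∘ suc)))
    (sym (+-assoc (f 0) _ _))

  -- For `i ≤ n` these are the terms that row `i` holds left of the diagonal, before they are
  -- weighted.
  last-terms : ℕ → (ℕ → Carrier) → ℕ → Carrier
  last-terms n f i = sum-below i (f ∘ ((n ∸ i) ℕ.+_))

  sum-below-split : ∀ {n i} f → i ≤ n →
    sum-below n f ≈ sum-below (n ∸ i) f ⊕ last-terms n f i
  sum-below-split {n} {i} f i≤n = trans
    (reflexive (cong (λ m → sum-below m f) (≡.sym (ℕ.m∸n+n≡m i≤n))))
    (sum-below-+ (n ∸ i) i f)

  -- Raising `n` and `i` together leaves the starting index `n ∸ i` unchanged, so the block only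
  -- gains its new final term.
  last-terms-suc : ∀ {n i} f → i ≤ n →
    last-terms (suc n) f (suc i) ≈ last-terms n f i ⊕ f n
  last-terms-suc {n} {i} f i≤n = trans
    (sum-below-suc i (f ∘ ((n ∸ i) ℕ.+_)))
    (+-congˡ (reflexive (cong f (ℕ.m∸n+n≡m i≤n))))

  -- Induction on `n`: in size `suc n` row 0 has an empty block, and each of the other `n` rows is a
  -- row of size `n` extended by `f n`. The `n` copies of `f n` form the last term on the right.
  sum-last-terms : ∀ n f → sum-below n (last-terms n f) ≈ sum-below n (λ i → i · f i)
  sum-last-terms zero    f = refl
  sum-last-terms (suc n) f = begin
    0# ⊕ sum {n} (λ i → last-terms (suc n) f (suc (toℕ i)))
      ≈⟨ +-identityˡ _ ⟩
    sum {n} (λ i → last-terms (suc n) f (suc (toℕ i)))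
      ≈⟨ sum-cong-≋ (λ i → last-terms-suc f (ℕ.<⇒≤ (Fin.toℕ<n {n} i))) ⟩
    sum {n} (λ i → last-terms n f (toℕ i) ⊕ f n)
      ≈⟨ ∑-distrib-+ {n} (last-terms n f ∘ toℕ) (λ _ → f n) ⟩
    sum-below n (last-terms n f) ⊕ sum {n} (λ _ → f n)
      ≈⟨ +-cong (sum-last-terms n f) (sum-replicate n) ⟩
    sum-below n (λ i → i · f i) ⊕ n · f n
      ≈⟨ sum-below-suc n (λ i → i · f i) ⟨
    sum-below (suc n) (λ i → i · f i) ∎

  -- Each induction step peels off column 0, which belongs to `u`, and lowers `n` and `i` together,
  -- so `n ∸ i` and all differences `toℕ j ∸ i` are preserved. The `f` block is put first because
  -- `sum-below-split` continues it with the wrapped terms.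
  sum-rotated : ∀ {n i} (f u : ℕ → Carrier) → i ≤ n → (g : Fin n → Carrier) →
    (∀ j → i ≤ toℕ j → g j ≈ f (toℕ j ∸ i)) →
    (∀ j → toℕ j ℕ.< i → g j ≈ u (toℕ j)) →
    sum g ≈ sum-below (n ∸ i) f ⊕ sum-below i u
  sum-rotated {i = zero} f u _ g right left =
    trans (sum-cong-≋ λ j → right j z≤n) (sym (+-identityʳ _))
  sum-rotated {suc n} {suc i} f u (s≤s i≤n) g right left = trans
    (+-cong (left Fin.zero (s≤s z≤n))
      (sum-rotated f (u ∘ suc) i≤n (g ∘ Fin.suc)
        (λ j i≤j → right (Fin.suc j) (s≤s i≤j))
        (λ j j<i → left (Fin.suc j) (s≤s j<i))))
    (x∙yz≈y∙xz (u 0) _ _)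

  -- The weight of the entries below the diagonal is 1 + y, so that no
  -- subtraction is needed.
  module _ {n : ℕ} (f : ℕ → Carrier) (y : Carrier) (h : Fin n → Fin n → Carrier)
    (upper : ∀ i j → toℕ i ≤ toℕ j → h i j ≈ f (toℕ j ∸ toℕ i))
    (lower : ∀ i j → toℕ j ℕ.< toℕ i →
      h i j ≈ f (n ℕ.+ toℕ j ∸ toℕ i) ⊕ y ⊗ f (n ℕ.+ toℕ j ∸ toℕ i))
    where

    -- One unweighted copy of the wrapped terms completes the terms right of the diagonal to the
    -- full sum of `f`; what remains is the copy weighted by `y`.
    row-sum : ∀ i → sum (h i) ≈ sum-below n f ⊕ y ⊗ last-terms n f (toℕ i)
    row-sum i = begin
      sum (h i)
        ≈⟨ sum-rotated f (λ j → f (m ℕ.+ j) ⊕ y ⊗ f (m ℕ.+ j)) i≤n (h i) (upper i) lower′ ⟩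
      sum-below m f ⊕ sum-below (toℕ i) (λ j → f (m ℕ.+ j) ⊕ y ⊗ f (m ℕ.+ j))
        ≈⟨ +-congˡ (∑-distrib-+ {toℕ i} (λ j → f (m ℕ.+ toℕ j)) _) ⟩
      sum-below m f ⊕ (T ⊕ sum-below (toℕ i) (λ j → y ⊗ f (m ℕ.+ j)))
        ≈⟨ +-assoc _ _ _ ⟨
      (sum-below m f ⊕ T) ⊕ sum-below (toℕ i) (λ j → y ⊗ f (m ℕ.+ j))
        ≈⟨ +-cong (sum-below-split f i≤n)
             (*-distribˡ-sum {toℕ i} y (λ j → f (m ℕ.+ toℕ j))) ⟨
      sum-below n f ⊕ y ⊗ T ∎
      where
      m = n ∸ toℕ i
      T = last-terms n f (toℕ i)
      i≤n : toℕ i ≤ n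
      i≤n = ℕ.<⇒≤ (Fin.toℕ<n i)
      lower′ : ∀ j → toℕ j ℕ.< toℕ i →
               h i j ≈ f (m ℕ.+ toℕ j) ⊕ y ⊗ f (m ℕ.+ toℕ j)
      -- As `i ≤ n`, the wrapped index `n + j ∸ i` is `(n ∸ i) + j`, the `j`-th index of
      -- `last-terms`.
      lower′ j j<i = subst (λ l → h i j ≈ f l ⊕ y ⊗ f l)
        (ℕ.+-∸-comm (toℕ j) i≤n) (lower i j j<i)

    circulant-sum : sum (λ i → sum (h i)) ≈
                    n · sum-below n f ⊕ y ⊗ sum-below n (λ i → i · f i)
    circulant-sum = begin
      sum (λ i → sum (h i))
        ≈⟨ sum-cong-≋ row-sum ⟩
      sum {n} (λ i → sum-below n f ⊕ y ⊗ last-terms n f (toℕ i))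
        ≈⟨ ∑-distrib-+ {n} (λ _ → sum-below n f) _ ⟩
      sum {n} (λ _ → sum-below n f) ⊕ sum {n} (λ i → y ⊗ last-terms n f (toℕ i))
        ≈⟨ +-cong (sum-replicate n)
             (sym (*-distribˡ-sum {n} y (last-terms n f ∘ toℕ))) ⟩
      n · sum-below n f ⊕ y ⊗ sum-below n (last-terms n f)
        ≈⟨ +-congˡ (*-congˡ (sum-last-terms n f)) ⟩
      n · sum-below n f ⊕ y ⊗ sum-below n (λ i → i · f i) ∎

-- Equality of reals and its compatibility with the operations.

-- Since _≃_ unfolds to a function type, Agda cannot infer the related reals
-- from an equivalence; hence the many explicit implicit arguments below.
≃-refl : ∀ {x} → x ≃ x
≃-refl {x} ε 0<ε = 0 , λ n _ →
  subst (ℚ._< ε) (≡.sym (cong ℚ.∣_∣ (ℚ.+-inverseʳ (seq x n)))) 0<ε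

seq-≡⇒≃ : ∀ x y → (∀ n → seq x n ≡ seq y n) → x ≃ y
seq-≡⇒≃ x y h ε 0<ε = 0 , λ n _ →
  subst (ℚ._< ε)
    (≡.sym (cong ℚ.∣_∣ (≡.trans (cong (ℚ._- seq y n) (h n)) (ℚ.+-inverseʳ (seq y n)))))
    0<ε

≃-sym : ∀ {x y} → x ≃ y → y ≃ x
≃-sym {x} {y} x≃y ε 0<ε with x≃y ε 0<ε
... | N , h = N , λ n N≤n → ∣-∣<⇐ {seq y n} {seq x n}
  (∣-∣<⇒ (subst (ℚ._< ε) (∣p-q∣≡∣q-p∣ (seq x n) (seq y n)) (h n N≤n)))
  (∣-∣<⇒ (h n N≤n))
  where
  ∣p-q∣≡∣q-p∣ : ∀ p q → ℚ.∣ p ℚ.- q ∣ ≡ ℚ.∣ q ℚ.- p ∣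
  ∣p-q∣≡∣q-p∣ p q = ≡.trans (cong ℚ.∣_∣ (p-q≡-[q-p] p q)) (ℚ.∣-p∣≡∣p∣ (q ℚ.- p))

private
  ⊔ˡ : ∀ {a b c} → a ℕ.⊔ b ≤ c → a ≤ c
  ⊔ˡ {a} {b} = ℕ.m⊔n≤o⇒m≤o a b

  ⊔ʳ : ∀ {a b c} → a ℕ.⊔ b ≤ c → b ≤ c
  ⊔ʳ {a} {b} = ℕ.m⊔n≤o⇒n≤o a b

-- The usual ε/2 argument, shared by transitivity and the congruence of addition.
null-+ : ∀ {x x′ y y′} (u : ℕ → ℚ) → x ≃ x′ → y ≃ y′ →
  (∀ n → ℚ.∣ u n ∣ ℚ.≤ ℚ.∣ seq x n ℚ.- seq x′ n ∣ ℚ.+ ℚ.∣ seq y n ℚ.- seq y′ n ∣) →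
  ∀ ε → 0ℚ ℚ.< ε → ∃[ N ] (∀ n → N ≤ n → ℚ.∣ u n ∣ ℚ.< ε)
null-+ u x≃x′ y≃y′ bound ε 0<ε
  with x≃x′ (½ ℚ.* ε) (½-pos 0<ε) | y≃y′ (½ ℚ.* ε) (½-pos 0<ε)
... | M , hM | N , hN = M ℕ.⊔ N , λ n p → ℚ.≤-<-trans (bound n)
  (subst (_ ℚ.<_) (½+½ ε) (ℚ.+-mono-< (hM n (⊔ˡ p)) (hN n (⊔ʳ {M} p))))

≃-trans : ∀ {x y z} → x ≃ y → y ≃ z → x ≃ z
≃-trans {x} {y} {z} x≃y y≃z = null-+ {x} {y} {y} {z} _ x≃y y≃z λ n →
  let p = seq x n; q = seq y n; r = seq z n in
  subst (λ t → ℚ.∣ t ∣ ℚ.≤ ℚ.∣ p ℚ.- q ∣ ℚ.+ ℚ.∣ q ℚ.- r ∣)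
    (S.solve 3 (λ p q r → (p S.:- q) S.:+ (q S.:- r) S.:= p S.:- r) ≡.refl p q r)
    (ℚ.∣p+q∣≤∣p∣+∣q∣ (p ℚ.- q) (q ℚ.- r))

+-cong : ∀ {x x′ y y′} → x ≃ x′ → y ≃ y′ → x + y ≃ x′ + y′
+-cong {x} {x′} {y} {y′} x≃x′ y≃y′ = null-+ {x} {x′} {y} {y′} _ x≃x′ y≃y′ λ n →
  let a = seq x n; b = seq x′ n; c = seq y n; d = seq y′ n in
  subst (λ t → ℚ.∣ t ∣ ℚ.≤ ℚ.∣ a ℚ.- b ∣ ℚ.+ ℚ.∣ c ℚ.- d ∣)
    (sum-difference a b c d)
    (ℚ.∣p+q∣≤∣p∣+∣q∣ (a ℚ.- b) (c ℚ.- d))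

-- Abstract because unfolding these during type checking is prohibitively slow.
abstract
  *-cong : ∀ {x x′ y y′} → x ≃ x′ → y ≃ y′ → x * y ≃ x′ * y′
  *-cong {x} {x′} {y} {y′} x≃x′ y≃y′ ε 0<ε =
    -- The difference of products is split as a(c - d) + d(a - b), so bounds are needed only for `x`
    -- and `y′`.
    let B , M  , 0<B , hB = eventually-bounded (seq x) (cauchy x)
        C , M′ , 0<C , hC = eventually-bounded (seq y′) (cauchy y′)
        η , 0<η , Bη = divide B (½ ℚ.* ε) 0<B (½-pos 0<ε)
        θ , 0<θ , Cθ = divide C (½ ℚ.* ε) 0<C (½-pos 0<ε)
        N  , hN  = y≃y′ η 0<η
        N′ , hN′ = x≃x′ θ 0<θ
    in close 0<B 0<C Bη Cθ hB hC hN hN′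
    where
    close : ∀ {B C η θ M M′ N N′} → 0ℚ ℚ.< B → 0ℚ ℚ.< C →
            B ℚ.* η ≡ ½ ℚ.* ε → C ℚ.* θ ≡ ½ ℚ.* ε →
            (∀ n → M  ≤ n → ℚ.∣ seq x n ∣ ℚ.≤ B) →
            (∀ n → M′ ≤ n → ℚ.∣ seq y′ n ∣ ℚ.≤ C) →
            (∀ n → N  ≤ n → ℚ.∣ seq y n ℚ.- seq y′ n ∣ ℚ.< η) →
            (∀ n → N′ ≤ n → ℚ.∣ seq x n ℚ.- seq x′ n ∣ ℚ.< θ) →
            ∃[ K ] (∀ n → K ≤ n →
              ℚ.∣ seq x n ℚ.* seq y n ℚ.- seq x′ n ℚ.* seq y′ n ∣ ℚ.< ε)
    close {M = M} {M′} {N} {N′} 0<B 0<C Bη Cθ hB hC hN hN′ =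
      (M ℕ.⊔ M′) ℕ.⊔ (N ℕ.⊔ N′) , λ n p →
        let pM = ⊔ˡ {M ℕ.⊔ M′} p; pN = ⊔ʳ {M ℕ.⊔ M′} p in
        *-close (seq x n) (seq x′ n) (seq y n) (seq y′ n) 0<B 0<C Bη Cθ
          (hB n (⊔ˡ {M} pM)) (hC n (⊔ʳ {M} pM))
          (hN n (⊔ˡ {N} pN)) (hN′ n (⊔ʳ {N} pN))

  √-cong : ∀ {x y} → x ≃ y → √ x ≃ √ y
  √-cong {x} {y} x≃y ε 0<ε =
    -- With δ = ε/2, `√ℚ-continuous` turns a distance below δ² between the radicands into one below
    -- 2δ = ε between the roots, once the rounding error `step n` is at most δ.
    let 0<δ      = ½-pos 0<ε
        M , hM   = archimedean (½ ℚ.* ε) 0<δ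
        0<δ²     = *-pos 0<δ 0<δ
        N  , hN  = x≃y _ 0<δ²
        N′ , hN′ = ≃-sym {x} {y} x≃y _ 0<δ²
    in close {½ ℚ.* ε} {M} {N} {N′} 0<δ (½+½ ε) hM hN hN′
    where
    close : ∀ {δ M N N′} → 0ℚ ℚ.< δ → δ ℚ.+ δ ≡ ε → step M ℚ.≤ δ →
            (∀ n → N  ≤ n → ℚ.∣ seq x n ℚ.- seq y n ∣ ℚ.< δ ℚ.* δ) →
            (∀ n → N′ ≤ n → ℚ.∣ seq y n ℚ.- seq x n ∣ ℚ.< δ ℚ.* δ) →
            ∃[ K ] (∀ n → K ≤ n →
              ℚ.∣ √ℚ n (seq x n ℚ.⊔ 0ℚ) ℚ.- √ℚ n (seq y n ℚ.⊔ 0ℚ) ∣ ℚ.< ε)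
    close {δ} {M} {N} {N′} 0<δ δ+δ≡ε hM hN hN′ = M ℕ.⊔ (N ℕ.⊔ N′) , λ n p →
      let q = ⊔ʳ {M} p in
      ∣-∣<⇐ {√ℚ n (seq x n ℚ.⊔ 0ℚ)} {√ℚ n (seq y n ℚ.⊔ 0ℚ)}
        (bound {seq x n} {seq y n} n (⊔ˡ {M} p) (hN n (⊔ˡ {N} q)))
        (bound {seq y n} {seq x n} n (⊔ˡ {M} p) (hN′ n (⊔ʳ {N} q)))
      where
      bound : ∀ {p q} n → M ≤ n → ℚ.∣ p ℚ.- q ∣ ℚ.< δ ℚ.* δ →
              √ℚ n (p ℚ.⊔ 0ℚ) ℚ.< √ℚ n (q ℚ.⊔ 0ℚ) ℚ.+ ε
      bound {p} {q} n M≤n h =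
        subst (λ t → √ℚ n (p ℚ.⊔ 0ℚ) ℚ.< √ℚ n (q ℚ.⊔ 0ℚ) ℚ.+ t) δ+δ≡ε
          (√ℚ-continuous n n (ℚ.p≤q⊔p p 0ℚ) (ℚ.p≤q⊔p q 0ℚ) 0<δ
            (ℚ.≤-trans (step-antitone M≤n) hM)
            (⊔0-lipschitz {p} {q} (*-pos 0<δ 0<δ) (∣-∣<⇒ h)))

p<p+ε : ∀ p {ε} → 0ℚ ℚ.< ε → p ℚ.< p ℚ.+ ε
p<p+ε p {ε} 0<ε = subst (ℚ._< p ℚ.+ ε) (ℚ.+-identityʳ p) (ℚ.+-monoʳ-< p 0<ε)

-- This absorbs the rounding in `√ℚ`, which places a sequence termwise between two representatives
-- of the same real.
≃-squeeze : ∀ x y z → x ≃ z → (∀ n → seq x n ℚ.≤ seq y n) →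
            (∀ n → seq y n ℚ.≤ seq z n) → y ≃ x
≃-squeeze x y z x≃z x≤y y≤z ε 0<ε =
  let N , h = ≃-sym {x} {z} x≃z ε 0<ε in N , λ n N≤n →
  ∣-∣<⇐ {seq y n} {seq x n} {ε}
    (ℚ.≤-<-trans {seq y n} {seq z n} {seq x n ℚ.+ ε} (y≤z n)
      (∣-∣<⇒ {seq z n} {seq x n} {ε} (h n N≤n)))
    (ℚ.≤-<-trans {seq x n} {seq y n} {seq y n ℚ.+ ε} (x≤y n) (p<p+ε (seq y n) 0<ε))

≃-isEquivalence : IsEquivalence _≃_
≃-isEquivalence = record
  { refl  = λ {x} → ≃-refl {x}
  ; sym   = λ {x} {y} → ≃-sym {x} {y}
  ; trans = λ {x} {y} {z} → ≃-trans {x} {y} {z}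
  }

-- The semiring of reals.

ℝ-semiring : Semiring 0ℓ 0ℓ
ℝ-semiring = record
  { Carrier = ℝ ; _≈_ = _≃_ ; _+_ = _+_ ; _*_ = _*_ ; 0# = 0ℝ ; 1# = 1ℝ
  ; isSemiring = record
    { isSemiringWithoutAnnihilatingZero = record
      { +-isCommutativeMonoid = record
        { isMonoid = record
          { isSemigroup = record
            { isMagma = record
              { isEquivalence = ≃-isEquivalence
              ; ∙-cong = λ {x} {x′} {y} {y′} → +-cong {x} {x′} {y} {y′}
              }
            ; assoc = λ x y z → seq-≡⇒≃ (x + y + z) (x + (y + z))
                λ n → ℚ.+-assoc (seq x n) (seq y n) (seq z n)
            }
          ; identity = (λ x → seq-≡⇒≃ (0ℝ + x) x λ n → ℚ.+-identityˡ (seq x n))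
                     , (λ x → seq-≡⇒≃ (x + 0ℝ) x λ n → ℚ.+-identityʳ (seq x n))
          }
        ; comm = λ x y → seq-≡⇒≃ (x + y) (y + x) λ n → ℚ.+-comm (seq x n) (seq y n)
        }
      ; *-cong = λ {x} {x′} {y} {y′} → *-cong {x} {x′} {y} {y′}
      ; *-assoc = λ x y z → seq-≡⇒≃ (x * y * z) (x * (y * z))
          λ n → ℚ.*-assoc (seq x n) (seq y n) (seq z n)
      ; *-identity = (λ x → seq-≡⇒≃ (1ℝ * x) x λ n → ℚ.*-identityˡ (seq x n))
                   , (λ x → seq-≡⇒≃ (x * 1ℝ) x λ n → ℚ.*-identityʳ (seq x n))
      ; distrib = (λ x y z → seq-≡⇒≃ (x * (y + z)) (x * y + x * z)
                    λ n → ℚ.*-distribˡ-+ (seq x n) (seq y n) (seq z n))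
                , (λ x y z → seq-≡⇒≃ ((y + z) * x) (y * x + z * x)
                    λ n → ℚ.*-distribʳ-+ (seq x n) (seq y n) (seq z n))
      }
    ; zero = (λ x → seq-≡⇒≃ (0ℝ * x) 0ℝ λ n → ℚ.*-zeroˡ (seq x n))
           , (λ x → seq-≡⇒≃ (x * 0ℝ) 0ℝ λ n → ℚ.*-zeroʳ (seq x n))
    }
  }

-- Square roots of nonnegative reals.

eventually-step< : ∀ ε → 0ℚ ℚ.< ε → ∃[ N ] (∀ n → N ≤ n → step n ℚ.< ε)
eventually-step< ε 0<ε =
  let N , step-N≤½ε = archimedean (½ ℚ.* ε) (½-pos 0<ε) in
  N , λ n N≤n → ℚ.≤-<-trans (ℚ.≤-trans (step-antitone N≤n) step-N≤½ε)
    (subst (½ ℚ.* ε ℚ.<_) (½+½ ε) (p<p+ε (½ ℚ.* ε) (½-pos 0<ε)))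

q<ε⇒q<p+ε : ∀ {p q ε} → 0ℚ ℚ.≤ p → q ℚ.< ε → q ℚ.< p ℚ.+ ε
q<ε⇒q<p+ε {p} {q} {ε} 0≤p q<ε = subst (ℚ._< p ℚ.+ ε) (ℚ.+-identityˡ q)
  (ℚ.+-mono-≤-< 0≤p q<ε)

-- The rounding error of `√` packaged as a real, so that the bounds on `√ℚ` become termwise
-- inequalities between reals.
steps : ℝ
seq    steps = step
cauchy steps ε 0<ε =
  let N , h = eventually-step< ε 0<ε in N , λ m n N≤m N≤n →
  ∣-∣<⇐ {step m} {step n} {ε}
    (q<ε⇒q<p+ε (ℚ.<⇒≤ (step-pos n)) (h m N≤m))
    (q<ε⇒q<p+ε (ℚ.<⇒≤ (step-pos m)) (h n N≤n))

steps≃0 : steps ≃ 0ℝ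
steps≃0 ε 0<ε =
  let N , h = eventually-step< ε 0<ε in N , λ n N≤n →
  ∣-∣<⇐ {step n} {0ℚ} {ε}
    (q<ε⇒q<p+ε ℚ.≤-refl (h n N≤n))
    (q<ε⇒q<p+ε (ℚ.<⇒≤ (step-pos n)) 0<ε)

x≃x+steps : ∀ x → x ≃ x + steps
x≃x+steps x = ≃-trans {x} {x + 0ℝ} {x + steps}
  (seq-≡⇒≃ x (x + 0ℝ) λ n → ≡.sym (ℚ.+-identityʳ (seq x n)))
  (+-cong {x} {x} {0ℝ} {steps} (≃-refl {x}) (≃-sym {steps} {0ℝ} steps≃0))

-- A condition on the chosen sequence, not invariant under `≃`. It is what the termwise bounds
-- `√ℚ-lower` and `√ℚ-upper` require, and squares, roots and embedded naturals satisfy it.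
Nonnegative : ℝ → Set
Nonnegative x = ∀ n → 0ℚ ℚ.≤ seq x n

p²≤q²⇒p≤q : ∀ {p q} → 0ℚ ℚ.≤ q → p ℚ.* p ℚ.≤ q ℚ.* q → p ℚ.≤ q
p²≤q²⇒p≤q {p} {q} 0≤q p²≤q² with p ℚ.≤? q
... | yes p≤q = p≤q
... | no  p≰q = ⊥-elim (ℚ.<-irrefl ≡.refl (ℚ.<-≤-trans q²<p² p²≤q²))
  where
  q<p : q ℚ.< p
  q<p = ℚ.≰⇒> p≰q
  q²<p² : q ℚ.* q ℚ.< p ℚ.* p
  q²<p² = ℚ.≤-<-trans (*-mono-≤ 0≤q ℚ.≤-refl 0≤q (ℚ.<⇒≤ q<p))
    (ℚ.*-monoˡ-<-pos p {{ℚ.positive (ℚ.≤-<-trans 0≤q q<p)}} q<p)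

√-nonneg : ∀ x → Nonnegative (√ x)
√-nonneg x n = √ℚ-nonNeg n (seq x n ℚ.⊔ 0ℚ)

module _ (x : ℝ) (x-nonneg : Nonnegative x) where
  private
    -- On nonnegative terms the truncation `⊔ 0ℚ` inside `√` changes nothing.
    √ℚ-seq : ∀ n → √ℚ n (seq x n) ≡ seq (√ x) n
    √ℚ-seq n = cong (√ℚ n) (≡.sym (ℚ.p≥q⇒p⊔q≡p (x-nonneg n)))

  √-lower : ∀ n → seq (√ x ²) n ℚ.≤ seq x n
  √-lower n = subst (λ s → s ℚ.* s ℚ.≤ seq x n) (√ℚ-seq n) (√ℚ-lower n (x-nonneg n))

  √-upper : ∀ n → seq x n ℚ.≤ seq ((√ x + steps) ²) n
  √-upper n = subst (λ s → seq x n ℚ.≤ (s ℚ.+ step n) ℚ.* (s ℚ.+ step n)) (√ℚ-seq n)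
    (ℚ.<⇒≤ (√ℚ-upper n (x-nonneg n)))

  -- Termwise, `x` lies between the squares of `√ x` and `√ x + steps`, and these squares are equal
  -- reals because `steps` is null.
  √x²≃x : √ x ² ≃ x
  √x²≃x = ≃-sym {x} {√ x ²} (≃-squeeze (√ x ²) x ((√ x + steps) ²)
    (*-cong {√ x} {√ x + steps} {√ x} {√ x + steps} (x≃x+steps (√ x)) (x≃x+steps (√ x)))
    √-lower √-upper)

square-nonneg : ∀ x → Nonnegative (x ²)
square-nonneg x n with ℚ.≤-total 0ℚ (seq x n)
... | inj₁ 0≤p = *-mono-≤ ℚ.≤-refl 0≤p ℚ.≤-refl 0≤p
... | inj₂ p≤0 = subst (0ℚ ℚ.≤_) (neg-square (seq x n)) (*-mono-≤ ℚ.≤-refl 0≤-p ℚ.≤-refl 0≤-p)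
  where
  0≤-p : 0ℚ ℚ.≤ ℚ.- seq x n
  0≤-p = ℚ.neg-antimono-≤ p≤0
  neg-square : ∀ p → ℚ.- p ℚ.* ℚ.- p ≡ p ℚ.* p
  neg-square = S.solve 1 (λ p → S.:- p S.:* S.:- p S.:= p S.:* p) ≡.refl

-- The rounded root s of `x ²` satisfies s² ≤ x² ≤ (s + step)² termwise. Nonnegativity lets the
-- squares be removed, which squeezes `x` between s and s + step.
√[x²]≃x : ∀ x → Nonnegative x → √ (x ²) ≃ x
√[x²]≃x x x-nonneg = ≃-sym {x} {√ (x ²)} (≃-squeeze (√ (x ²)) x (√ (x ²) + steps)
  (x≃x+steps (√ (x ²)))
  (λ n → p²≤q²⇒p≤q (x-nonneg n) (√-lower (x ²) (square-nonneg x) n))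
  (λ n → p²≤q²⇒p≤q (ℚ.+-mono-≤ (√-nonneg (x ²) n) (ℚ.<⇒≤ (step-pos n)))
    (√-upper (x ²) (square-nonneg x) n)))

-- Multiplicativity of the complex absolute value.

norm² : ℂ → ℝ
norm² z = re z ² + im z ²

norm²-nonneg : ∀ z → Nonnegative (norm² z)
norm²-nonneg z n = ℚ.+-mono-≤ (square-nonneg (re z) n) (square-nonneg (im z) n)

∣z∣²≃norm² : ∀ z → ∣ z ∣ ² ≃ norm² z
∣z∣²≃norm² z = √x²≃x (norm² z) (norm²-nonneg z)

-- The Brahmagupta-Fibonacci two-square identity, applied termwise.
norm²-homo-* : ∀ z w → norm² (z *ᶜ w) ≃ norm² z * norm² w
norm²-homo-* z w = seq-≡⇒≃ (norm² (z *ᶜ w)) (norm² z * norm² w) λ n →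
  S.solve 4 (λ a b c d →
    (a S.:* c S.:- b S.:* d) S.:* (a S.:* c S.:- b S.:* d) S.:+
    (a S.:* d S.:+ b S.:* c) S.:* (a S.:* d S.:+ b S.:* c) S.:=
    (a S.:* a S.:+ b S.:* b) S.:* (c S.:* c S.:+ d S.:* d)) ≡.refl
    (seq (re z) n) (seq (im z) n) (seq (re w) n) (seq (im w) n)

square-* : ∀ x y → x ² * y ² ≃ (x * y) ²
square-* x y = seq-≡⇒≃ (x ² * y ²) ((x * y) ²) λ n →
  S.solve 2 (λ x y → (x S.:* x) S.:* (y S.:* y) S.:= (x S.:* y) S.:* (x S.:* y)) ≡.refl
    (seq x n) (seq y n)

-- Under the root, each squared norm is rewritten as the square of an absolute value; the radicand
-- is then the square of a nonnegative product, and the root cancels.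
∣∣-homo-* : ∀ z w → ∣ z *ᶜ w ∣ ≃ ∣ z ∣ * ∣ w ∣
∣∣-homo-* z w = begin
  √ (norm² (z *ᶜ w))
    ≈⟨ √-cong {norm² (z *ᶜ w)} {norm² z * norm² w} (norm²-homo-* z w) ⟩
  √ (norm² z * norm² w)
    ≈⟨ √-cong {∣ z ∣ ² * ∣ w ∣ ²} {norm² z * norm² w}
         (*-cong {∣ z ∣ ²} {norm² z} {∣ w ∣ ²} {norm² w} (∣z∣²≃norm² z) (∣z∣²≃norm² w)) ⟨
  √ (∣ z ∣ ² * ∣ w ∣ ²)
    ≈⟨ √-cong {∣ z ∣ ² * ∣ w ∣ ²} {(∣ z ∣ * ∣ w ∣) ²} (square-* ∣ z ∣ ∣ w ∣) ⟩
  √ ((∣ z ∣ * ∣ w ∣) ²)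
    ≈⟨ √[x²]≃x (∣ z ∣ * ∣ w ∣) (λ n →
         *-mono-≤ ℚ.≤-refl (√-nonneg (norm² z) n) ℚ.≤-refl (√-nonneg (norm² w) n)) ⟩
  ∣ z ∣ * ∣ w ∣ ∎
  where
  open SetoidReasoning (Semiring.setoid ℝ-semiring)

∣fromℕᶜ∣ : ∀ m → ∣ fromℕᶜ m ∣ ≃ fromℕ m
∣fromℕᶜ∣ m = ≃-trans {∣ fromℕᶜ m ∣} {√ (fromℕ m ²)} {fromℕ m}
  (√-cong {norm² (fromℕᶜ m)} {fromℕ m ²}
    (seq-≡⇒≃ (norm² (fromℕᶜ m)) (fromℕ m ²) λ _ → ℚ.+-identityʳ (ι m ℚ.* ι m)))
  (√[x²]≃x (fromℕ m) λ _ → ι-mono-≤ {0} {m} z≤n)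

-- Natural numbers inside the reals and the circulant sum there.

module ℝ-Sum = CirculantSum ℝ-semiring
open SemiringSum ℝ-semiring using (sum-cong-≋)
open SemiringMult ℝ-semiring using (×-congʳ) renaming (_×_ to _·_)

private
  module Sumℕ = RawMonoidDefinitions ℕ.+-0-rawMonoid

fromℕ-+ : ∀ m n → fromℕ (m ℕ.+ n) ≃ fromℕ m + fromℕ n
fromℕ-+ m n = seq-≡⇒≃ (fromℕ (m ℕ.+ n)) (fromℕ m + fromℕ n) λ _ → ≡.sym (ι-+ m n)

fromℕ-* : ∀ m n → fromℕ (m ℕ.* n) ≃ fromℕ m * fromℕ n
fromℕ-* m n = seq-≡⇒≃ (fromℕ (m ℕ.* n)) (fromℕ m * fromℕ n) λ _ → ≡.sym (ι-* m n)

fromℕ-² : ∀ m → fromℕ m ² ≃ fromℕ (m ℕ.^ 2)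
fromℕ-² m = subst (λ l → fromℕ m ² ≃ fromℕ (m ℕ.* l)) (≡.sym (ℕ.*-identityʳ m))
  (≃-sym {fromℕ (m ℕ.* m)} {fromℕ m ²} (fromℕ-* m m))

-- `circulant-sum` counts by repeated addition `·`, while the theorem multiplies by embedded
-- naturals; this translates between the two.
fromℕ-· : ∀ m n → fromℕ (m ℕ.* n) ≃ m · fromℕ n
fromℕ-· zero    n = ≃-refl {0ℝ}
fromℕ-· (suc m) n = ≃-trans {fromℕ (n ℕ.+ m ℕ.* n)} {fromℕ n + fromℕ (m ℕ.* n)}
  {fromℕ n + m · fromℕ n}
  (fromℕ-+ n (m ℕ.* n))
  (+-cong {fromℕ n} {fromℕ n} {fromℕ (m ℕ.* n)} {m · fromℕ n}
    (≃-refl {fromℕ n}) (fromℕ-· m n))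

fromℕ-sum : ∀ {n} (t : Fin n → ℕ) → fromℕ (Sumℕ.sum t) ≃ ∑ (fromℕ ∘ t)
fromℕ-sum {zero}  t = ≃-refl {0ℝ}
fromℕ-sum {suc n} t = ≃-trans {fromℕ (t₀ ℕ.+ Sumℕ.sum t′)} {fromℕ t₀ + fromℕ (Sumℕ.sum t′)}
  {fromℕ t₀ + ∑ (fromℕ ∘ t′)}
  (fromℕ-+ t₀ (Sumℕ.sum t′))
  (+-cong {fromℕ t₀} {fromℕ t₀} {fromℕ (Sumℕ.sum t′)} {∑ (fromℕ ∘ t′)}
    (≃-refl {fromℕ t₀}) (fromℕ-sum t′))
  where
  t₀ = t Fin.zero
  t′ = t ∘ Fin.suc

-- Brings a weight `x` into the form 1 + (x - 1) in which `circulant-sum` takes the weight below the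
-- diagonal.
x*y≃y+[x-1]*y : ∀ x y → x * y ≃ y + (x - 1ℝ) * y
x*y≃y+[x-1]*y x y = seq-≡⇒≃ (x * y) (y + (x - 1ℝ) * y) λ n →
  S.solve 2 (λ x y → x S.:* y S.:= y S.:+ (x S.:- S.con 1ℚ) S.:* y) ≡.refl
    (seq x n) (seq y n)

module _ {n : ℕ} (f : ℕ → ℕ) (x : ℝ) (h : Fin n → Fin n → ℝ)
  (upper : ∀ i j → toℕ i ≤ toℕ j → h i j ≃ fromℕ (f (toℕ j ∸ toℕ i)))
  (lower : ∀ i j → toℕ j ℕ.< toℕ i → h i j ≃ x * fromℕ (f (n ℕ.+ toℕ j ∸ toℕ i)))
  where
  private
    y S W ∑f ∑if : ℝ
    y = x - 1ℝ
    S = fromℕ (Sumℕ.sum {n} (f ∘ toℕ))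
    W = fromℕ (Sumℕ.sum {n} λ i → toℕ i ℕ.* f (toℕ i))
    ∑f = ∑ {n} λ i → fromℕ (f (toℕ i))
    ∑if = ∑ {n} λ i → toℕ i · fromℕ (f (toℕ i))

    lower′ : ∀ i j → toℕ j ℕ.< toℕ i → let p = fromℕ (f (n ℕ.+ toℕ j ∸ toℕ i)) in
             h i j ≃ p + y * p
    lower′ i j j<i = let p = fromℕ (f (n ℕ.+ toℕ j ∸ toℕ i)) in
      ≃-trans {h i j} {x * p} {p + y * p} (lower i j j<i) (x*y≃y+[x-1]*y x p)

    ∑∑h≃n·∑f+y*∑if : (∑ λ i → ∑ λ j → h i j) ≃ n · ∑f + y * ∑if
    ∑∑h≃n·∑f+y*∑if = ℝ-Sum.circulant-sum (fromℕ ∘ f) y h upper lower′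

    n·∑f≃n*S : n · ∑f ≃ fromℕ n * S
    n·∑f≃n*S = ≃-trans {n · ∑f} {n · S} {fromℕ n * S}
      (×-congʳ n {∑f} {S} (≃-sym {S} {∑f} (fromℕ-sum {n} (f ∘ toℕ))))
      (≃-trans {n · S} {fromℕ (n ℕ.* Sumℕ.sum {n} (f ∘ toℕ))} {fromℕ n * S}
        (≃-sym {fromℕ (n ℕ.* Sumℕ.sum {n} (f ∘ toℕ))} {n · S}
          (fromℕ-· n (Sumℕ.sum {n} (f ∘ toℕ))))
        (fromℕ-* n (Sumℕ.sum {n} (f ∘ toℕ))))

    W≃∑if : W ≃ ∑if
    W≃∑if = ≃-trans {W} {∑ {n} (λ i → fromℕ (toℕ i ℕ.* f (toℕ i)))} {∑if}
      (fromℕ-sum {n} (λ i → toℕ i ℕ.* f (toℕ i)))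
      (sum-cong-≋ {n} {λ i → fromℕ (toℕ i ℕ.* f (toℕ i))}
        {λ i → toℕ i · fromℕ (f (toℕ i))} (λ i → fromℕ-· (toℕ i) (f (toℕ i))))

  ∑∑-circulant : (∑ λ i → ∑ λ j → h i j) ≃ fromℕ n * S + y * W
  ∑∑-circulant = ≃-trans {∑ λ i → ∑ λ j → h i j} {n · ∑f + y * ∑if} {fromℕ n * S + y * W}
    ∑∑h≃n·∑f+y*∑if
    (+-cong {n · ∑f} {fromℕ n * S} {y * ∑if} {y * W} n·∑f≃n*S
      (*-cong {y} {y} {∑if} {W} (≃-refl {y}) (≃-sym {W} {∑if} W≃∑if)))

-- Entries and norms of the circulant matrix.

module _ {n : ℕ} (r : ℂ) (a : ℕ → ℂ) (i j : Fin n) where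
  Circ-upper : toℕ i ≤ toℕ j → Circ r (a ∘ toℕ) i j ≡ a (toℕ j ∸ toℕ i)
  Circ-upper i≤j with toℕ i ℕ.≤? toℕ j
  ... | yes _  = cong a (Fin.toℕ-fromℕ< _)
  ... | no i≰j = ⊥-elim (i≰j i≤j)

  Circ-lower : toℕ j ℕ.< toℕ i → Circ r (a ∘ toℕ) i j ≡ r *ᶜ a (n ℕ.+ toℕ j ∸ toℕ i)
  Circ-lower j<i with toℕ i ℕ.≤? toℕ j
  ... | yes i≤j = ⊥-elim (ℕ.<⇒≱ j<i i≤j)
  ... | no _    = cong (λ m → r *ᶜ a m) (Fin.toℕ-fromℕ< _)

module _ {n : ℕ} (r : ℂ) (p : ℕ → ℕ) where
  private
    𝐀 : Matrix n
    𝐀 = Circ r (λ l → fromℕᶜ (p (toℕ l)))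

  ∣𝐀∣-upper : ∀ i j → toℕ i ≤ toℕ j → ∣ 𝐀 i j ∣ ≃ fromℕ (p (toℕ j ∸ toℕ i))
  ∣𝐀∣-upper i j i≤j =
    subst (λ z → ∣ z ∣ ≃ fromℕ (p (toℕ j ∸ toℕ i))) (≡.sym (Circ-upper r (fromℕᶜ ∘ p) i j i≤j))
      (∣fromℕᶜ∣ (p (toℕ j ∸ toℕ i)))

  ∣𝐀∣-lower : ∀ i j → toℕ j ℕ.< toℕ i →
              ∣ 𝐀 i j ∣ ≃ ∣ r ∣ * fromℕ (p (n ℕ.+ toℕ j ∸ toℕ i))
  ∣𝐀∣-lower i j j<i =
    subst (λ z → ∣ z ∣ ≃ ∣ r ∣ * fromℕ q) (≡.sym (Circ-lower r (fromℕᶜ ∘ p) i j j<i))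
      (≃-trans {∣ r *ᶜ fromℕᶜ q ∣} {∣ r ∣ * ∣ fromℕᶜ q ∣} {∣ r ∣ * fromℕ q}
        (∣∣-homo-* r (fromℕᶜ q))
        (*-cong {∣ r ∣} {∣ r ∣} {∣ fromℕᶜ q ∣} {fromℕ q} (≃-refl {∣ r ∣}) (∣fromℕᶜ∣ q)))
    where
    q = p (n ℕ.+ toℕ j ∸ toℕ i)

  ∣𝐀∣²-upper : ∀ i j → toℕ i ≤ toℕ j → ∣ 𝐀 i j ∣ ² ≃ fromℕ (p (toℕ j ∸ toℕ i) ℕ.^ 2)
  ∣𝐀∣²-upper i j i≤j = let q = p (toℕ j ∸ toℕ i); e = ∣𝐀∣-upper i j i≤j in
    ≃-trans {∣ 𝐀 i j ∣ ²} {fromℕ q ²} {fromℕ (q ℕ.^ 2)}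
      (*-cong {∣ 𝐀 i j ∣} {fromℕ q} {∣ 𝐀 i j ∣} {fromℕ q} e e)
      (fromℕ-² q)

  ∣𝐀∣²-lower : ∀ i j → toℕ j ℕ.< toℕ i →
               ∣ 𝐀 i j ∣ ² ≃ ∣ r ∣ ² * fromℕ (p (n ℕ.+ toℕ j ∸ toℕ i) ℕ.^ 2)
  ∣𝐀∣²-lower i j j<i = begin
    ∣ 𝐀 i j ∣ ²
      ≈⟨ *-cong {∣ 𝐀 i j ∣} {∣ r ∣ * fromℕ q} {∣ 𝐀 i j ∣} {∣ r ∣ * fromℕ q} e e ⟩
    (∣ r ∣ * fromℕ q) ²
      ≈⟨ square-* ∣ r ∣ (fromℕ q) ⟨
    ∣ r ∣ ² * fromℕ q ²
      ≈⟨ *-cong {∣ r ∣ ²} {∣ r ∣ ²} {fromℕ q ²} {fromℕ (q ℕ.^ 2)}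
           (≃-refl {∣ r ∣ ²}) (fromℕ-² q) ⟩
    ∣ r ∣ ² * fromℕ (q ℕ.^ 2) ∎
    where
    open SetoidReasoning (Semiring.setoid ℝ-semiring)
    q = p (n ℕ.+ toℕ j ∸ toℕ i)
    e = ∣𝐀∣-lower i j j<i

  Frobenius-norm : ‖ 𝐀 ‖F ≃
    √ (fromℕ n * fromℕ (Sumℕ.sum {n} λ i → p (toℕ i) ℕ.^ 2) +
       (∣ r ∣ ² - 1ℝ) * fromℕ (Sumℕ.sum {n} λ i → toℕ i ℕ.* p (toℕ i) ℕ.^ 2))
  Frobenius-norm = √-cong {∑ λ i → ∑ λ j → ∣ 𝐀 i j ∣ ²}
    {fromℕ n * fromℕ (Sumℕ.sum {n} λ i → p (toℕ i) ℕ.^ 2) +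
     (∣ r ∣ ² - 1ℝ) * fromℕ (Sumℕ.sum {n} λ i → toℕ i ℕ.* p (toℕ i) ℕ.^ 2)}
    (∑∑-circulant (λ m → p m ℕ.^ 2) (∣ r ∣ ²) (λ i j → ∣ 𝐀 i j ∣ ²)
      ∣𝐀∣²-upper ∣𝐀∣²-lower)

  ℓ₁-norm : ‖ 𝐀 ‖₁ ≃
    fromℕ n * fromℕ (Sumℕ.sum {n} λ i → p (toℕ i)) +
    (∣ r ∣ - 1ℝ) * fromℕ (Sumℕ.sum {n} λ i → toℕ i ℕ.* p (toℕ i))
  ℓ₁-norm = ∑∑-circulant p ∣ r ∣ (λ i j → ∣ 𝐀 i j ∣) ∣𝐀∣-upper ∣𝐀∣-lower

theorem1 : (k n : ℕ) → 1 ≤ k → 2 ≤ n → (r : ℂ) →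
    let 𝐏 = Circ r (λ (i : Fin n) → fromℕᶜ (P k (toℕ i))) in
    ‖ 𝐏 ‖F ≃ √ (fromℕ n * fromℕ (S⁽²⁾ k (n ∸ 1)) + (∣ r ∣ ² - 1ℝ) * fromℕ (W⁽²⁾ k (n ∸ 1)))
    × ‖ 𝐏 ‖₁ ≃ fromℕ n * fromℕ (S⁽¹⁾ k (n ∸ 1)) + (∣ r ∣ - 1ℝ) * fromℕ (W⁽¹⁾ k (n ∸ 1))
-- The hypothesis `2 ≤ n` rules out size 0. At size `suc n`, `suc n ∸ 1` reduces to `n` and
-- `sum-to n` runs over `Fin (suc n)`, so the sums in both norms agree by computation.
theorem1 k (suc n) _ _ r = Frobenius-norm {suc n} r (P k) , ℓ₁-norm {suc n} r (P k)
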